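{- Let $m,n$ be positive integers. A tight signed magic array $SMA(m,n)$ exists if and only if one of the following holds: $m=n=1$; or $m=2$ and $n\equiv 0$ or $3 \pmod 4$; or $n=2$ and $m\equiv 0$ or $3\pmod 4$; or $m>2$ and $n>2$.
   Context: For positive integers $m,n$, a tight signed magic array $SMA(m,n)$ is an $m\times n$ array with every cell filled, whose entries come from the set $X$, where $X=\{0,\pm1,\pm2,\ldots,\pm (mn-1)/2\}$ if $mn$ is odd and $X=\{\pm1,\pm2,\ldots,\pm mn/2\}$ if $mn$ is even, such that every integer in $X$ appears exactly once in the array and every row sum and every column sum is zero. -}

module Defs where

open import Data.Fin.Base using (Fin)
open import Data.Integer.Base using (ℤ; 0ℤ; ∣_∣)
open import Data.Integer.Properties using (+-0-commutativeMonoid)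
open import Data.Nat.Base using (ℕ; _*_; _∸_; _≤_)
open import Data.Nat.DivMod using (_/_; _%_)
open import Data.Product using (_×_; _,_; ∃!)
open import Data.Vec.Functional using (Vector; transpose)
open import Level using (0ℓ)
open import Relation.Binary.PropositionalEquality using (_≡_)
open import Relation.Unary using (Pred; _∈_)

open import Algebra.Properties.CommutativeMonoid.Sum +-0-commutativeMonoid
  using (sum)

Array : ℕ → ℕ → Set
Array m n = Vector (Vector ℤ n) m

-- X N is {0, ±1, …, ±(N-1)/2} for odd N and {±1, …, ±N/2} for even N.
data X (N : ℕ) : Pred ℤ 0ℓ where
  odd  : ∀ {x} → N % 2 ≡ 1 → ∣ x ∣ ≤ (N ∸ 1) / 2 → x ∈ X N
  even : ∀ {x} → N % 2 ≡ 0 → 1 ≤ ∣ x ∣ → ∣ x ∣ ≤ N / 2 → x ∈ X N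

record IsTightSMA (m n : ℕ) (A : Array m n) : Set where
  field
    entries   : ∀ i j → A i j ∈ X (m * n)
    once      : ∀ x → x ∈ X (m * n) →
                ∃! {A = Fin m × Fin n} _≡_ λ (i , j) → A i j ≡ x
    rowSum    : ∀ i → sum (A i) ≡ 0ℤ
    columnSum : ∀ j → sum (transpose A j) ≡ 0ℤ

{-# OPTIONS --safe #-}

-- An array whose rows and columns all contain as many positive as negative entries keeps its zero sums
-- when a constant is added to all absolute values; the 2 × 4 array on ±{a, a+1, a+2, a+3} is of this kind.
-- Hence everything reduces to narrow pieces.  A triple a + b = c gives a 3 × 2 piece on ±{a, b, c}.  A
-- 3 × 3 piece on {0, ±x, ±w, ±(w+x), ±(w+2x)}, or a 3 × 4 piece on ±{a, b, c, a+b, a+c, a+b+c}, together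
-- with t such triples can be made to use the absolute values 1, …, M exactly once, as in Skolem sequences:
-- the triples (d, y, y + d) with d = d₀, d₀ + 2, … and nested pairs {y, y + d} fill two intervals.  One
-- chain for odd d, one for even d and a few further triples suffice; the core pieces supply the freedom
-- that removes the usual condition on t modulo 4.  For odd m and n an m × n array
-- consists of a 3 × 3 core, a 3-row strip and a 3-column strip of triples, and a remainder with even sides,
-- cut into 2 × 4 pieces (and one 2 × 6 piece made of two triples when both sides are 2 modulo 4).  For m odd
-- and n even the 3 × 4 core and a 3-row strip leave such a remainder.  If both are even, 2 × 4 pieces
-- suffice, except that a 6 × 6 piece built from the 3 × 4 core is needed when both are 2 modulo 4.
--
-- Conversely, the columns of a 2 × n array are (x, -x), so the absolute values in its first row are
-- 1, …, n; their sum n(n+1)/2 has the parity of the row sum 0.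
module Submission where

open import Defs
open import Data.Fin.Base using (Fin; zero; suc; toℕ; fromℕ<)
open import Data.Fin.Permutation using (permutation)
open import Data.Fin.Properties using (all?; toℕ-fromℕ<; toℕ-injective; toℕ<n)
open import Data.Integer.Base as ℤ using (ℤ; 0ℤ; +_; -_; -[1+_]; ∣_∣)
open import Data.Integer.Properties as ℤ using (+-0-commutativeMonoid)
import Data.Integer.Tactic.RingSolver as ℤ-Solver
open import Data.List.Base using (List; []; _∷_; _++_; concatMap; length; map; replicate; tabulate; upTo)
open import Data.List.Membership.Propositional using () renaming (_∈_ to _∈ˡ_; _∉_ to _∉ˡ_)
open import Data.List.Membership.Propositional.Properties
  using (∈-++⁺ˡ; ∈-++⁺ʳ; ∈-++⁻; ∈-tabulate⁺; ∈-tabulate⁻)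
open import Data.List.Properties
  using (++-assoc; ++-identityʳ; concatMap-++; length-++; length-tabulate)
open import Data.List.Relation.Binary.Permutation.Propositional as ↭
  using (_↭_; refl; prep; ↭-sym; ↭-trans; ↭-reflexive; ↭⇒↭ₛ; module PermutationReasoning)
open import Data.List.Relation.Binary.Permutation.Propositional.Properties
  using (++⁺; ++⁺ˡ; ++⁺ʳ; shift; shifts; ∈-resp-↭; ↭-length)
import Data.List.Relation.Binary.Permutation.Setoid.Properties as ↭ₛ
import Data.List.Relation.Unary.All as All
open import Data.List.Relation.Unary.All.Properties using (¬Any⇒All¬)
open import Data.List.Relation.Unary.AllPairs using ([]; _∷_)
open import Data.List.Relation.Unary.Any using (here; there)
open import Data.List.Relation.Unary.Unique.Propositional using (Unique)
open import Data.Nat.Base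
  using (ℕ; NonZero; >-nonZero; zero; suc; pred; _+_; _*_; _≤_; _<_; _>_; z≤n; s≤s)
open import Data.Nat.DivMod
  using (_/_; _%_; m*n/n≡m; m*n%n≡0; [m+kn]%n≡m%n; m≡m%n+[m/n]*n; m%n<n)
import Data.Nat.Properties as ℕ
import Data.Nat.Tactic.RingSolver as ℕ-Solver
open import Data.Product using (_×_; _,_; ∃; ∃₂; ∃!; -,_; map₂; proj₁; proj₂; swap)
open import Data.Sum.Base using (_⊎_; inj₁; inj₂; [_,_]′)
open import Data.Vec.Base as Vec using (Vec; []; _∷_)
open import Data.Vec.Functional using (Vector; tail; transpose)
open import Function.Base using (_∘_)
open import Function.Bundles using (_⇔_; mk⇔)
open import Relation.Binary.PropositionalEquality
  using (_≡_; _≢_; refl; sym; trans; cong; cong₂; subst; setoid; module ≡-Reasoning)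
open import Relation.Nullary.Decidable using (toWitness)
open import Relation.Nullary.Negation using (¬_; contradiction)
open import Relation.Unary using (_∈_)

open import Algebra.Properties.CommutativeMonoid.Sum +-0-commutativeMonoid using (sum)
import Algebra.Properties.CommutativeMonoid.Sum ℕ.+-0-commutativeMonoid as ℕ-Sum

open import Data.List.Sort.Base ℕ.≤-totalOrder using (module SortingAlgorithm)
open import Data.List.Sort.InsertionSort ℕ.≤-decTotalOrder using (insertionSort)
open SortingAlgorithm insertionSort using (sort; sort-↭)

-- Permutations of concatenated blocks

concatMap-↭ : ∀ {a b} {A : Set a} {B : Set b} (f : A → List B) {xs ys} → xs ↭ ys → concatMap f xs ↭ concatMap f ys
concatMap-↭ f refl           = refl
concatMap-↭ f (prep x p)     = ++⁺ˡ (f x) (concatMap-↭ f p)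
concatMap-↭ f (↭.swap x y p) =
  ↭-trans (shifts (f x) (f y)) (++⁺ˡ (f y) (++⁺ˡ (f x) (concatMap-↭ f p)))
concatMap-↭ f (↭.trans p q)  = ↭-trans (concatMap-↭ f p) (concatMap-↭ f q)

block : ∀ {a} {A : Set a} → List (List A) → ℕ → List A
block []        _       = []
block (xs ∷ _)  zero    = xs
block (_ ∷ xss) (suc i) = block xss i

-- The last block is not followed by ++ [], so that a selection unfolds to the expected concatenation.
select : ∀ {a} {A : Set a} → List (List A) → List ℕ → List A
select xss []               = []
select xss (i ∷ [])         = block xss i
select xss (i ∷ is@(_ ∷ _)) = block xss i ++ select xss is

select-concatMap : ∀ {a} {A : Set a} (xss : List (List A)) is → select xss is ≡ concatMap (block xss) is
select-concatMap xss []               = refl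
select-concatMap xss (i ∷ [])         = sym (++-identityʳ (block xss i))
select-concatMap xss (i ∷ is@(_ ∷ _)) = cong (block xss i ++_) (select-concatMap xss is)

-- Both index lists are closed, so sorting them decides whether they agree up to order.
rearrange : ∀ {a} {A : Set a} (xss : List (List A)) (is js : List ℕ) → sort is ≡ sort js →
            select xss is ↭ select xss js
rearrange xss is js eq = begin
  select xss is            ≡⟨ select-concatMap xss is ⟩
  concatMap (block xss) is ↭⟨ concatMap-↭ (block xss)
    (↭-trans (↭-sym (sort-↭ is)) (↭-trans (↭-reflexive eq) (sort-↭ js))) ⟩
  concatMap (block xss) js ≡⟨ select-concatMap xss js ⟨
  select xss js            ∎
  where open PermutationReasoning

-- Zero-sum tiles

signed : List ℕ → List ℤ
signed = concatMap λ k → + k ∷ - (+ k) ∷ []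

values : ℕ → List ℕ → List ℤ
values k L = replicate k 0ℤ ++ signed L

contents : ∀ {m n} → Array m n → List ℤ
contents {zero}  A = []
contents {suc m} A = tabulate (A zero) ++ contents (tail A)

-- `k` counts the zeros and `L` lists absolute values that occur with both signs. Keeping the
-- contents only up to order lets tiles be joined by concatenating their lists. Distinctness is
-- settled at the end, when `L` has become an interval starting at 1.
record Tile (m n k : ℕ) (L : List ℕ) : Set where
  field
    cells      : Array m n
    rowSums    : ∀ i → sum (cells i) ≡ 0ℤ
    columnSums : ∀ j → sum (transpose cells j) ≡ 0ℤ
    contents-↭ : contents cells ↭ values k L

open Tile

values-↭ : ∀ k {L L′} → L ↭ L′ → values k L ↭ values k L′
values-↭ k p = ++⁺ˡ (replicate k 0ℤ) (concatMap-↭ _ p)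

tile-resp-↭ : ∀ {m n k L L′} → L ↭ L′ → Tile m n k L → Tile m n k L′
tile-resp-↭ {k = k} p T = record
  { cells = cells T ; rowSums = rowSums T ; columnSums = columnSums T
  ; contents-↭ = ↭-trans (contents-↭ T) (values-↭ k p) }

replicate-++ : ∀ {a} {A : Set a} k l {x : A} → replicate (k + l) x ≡ replicate k x ++ replicate l x
replicate-++ zero    l = refl
replicate-++ (suc k) l = cong (_ ∷_) (replicate-++ k l)

values-++ : ∀ k L k′ L′ → values k L ++ values k′ L′ ↭ values (k + k′) (L ++ L′)
values-++ k L k′ L′ = begin
  (zs ++ signed L) ++ (zs′ ++ signed L′) ≡⟨ ++-assoc zs (signed L) _ ⟩
  zs ++ (signed L ++ (zs′ ++ signed L′)) ↭⟨ ++⁺ˡ zs (shifts (signed L) zs′) ⟩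
  zs ++ (zs′ ++ (signed L ++ signed L′)) ≡⟨ ++-assoc zs zs′ _ ⟨
  (zs ++ zs′) ++ (signed L ++ signed L′)
    ≡⟨ cong₂ _++_ (replicate-++ k k′) (concatMap-++ _ L L′) ⟨
  values (k + k′) (L ++ L′)              ∎
  where
  open PermutationReasoning
  zs  = replicate k 0ℤ
  zs′ = replicate k′ 0ℤ

stack : ∀ {m m′ n} → Array m n → Array m′ n → Array (m + m′) n
stack {zero}  A B         = B
stack {suc m} A B zero    = A zero
stack {suc m} A B (suc i) = stack (tail A) B i

stack-rowSum : ∀ {m m′ n} (A : Array m n) (B : Array m′ n) →
               (∀ i → sum (A i) ≡ 0ℤ) → (∀ i → sum (B i) ≡ 0ℤ) → ∀ i → sum (stack A B i) ≡ 0ℤ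
stack-rowSum {zero}  A B a b i       = b i
stack-rowSum {suc m} A B a b zero    = a zero
stack-rowSum {suc m} A B a b (suc i) = stack-rowSum (tail A) B (λ i → a (suc i)) b i

stack-columnSum : ∀ {m m′ n} (A : Array m n) (B : Array m′ n) j →
                  sum (transpose (stack A B) j) ≡ sum (transpose A j) ℤ.+ sum (transpose B j)
stack-columnSum {zero}  A B j = sym (ℤ.+-identityˡ _)
stack-columnSum {suc m} A B j =
  trans (cong (λ s → A zero j ℤ.+ s) (stack-columnSum (tail A) B j)) (sym (ℤ.+-assoc (A zero j) _ _))

stack-contents : ∀ {m m′ n} (A : Array m n) (B : Array m′ n) →
                 contents (stack A B) ≡ contents A ++ contents B
stack-contents {zero}  A B = refl
stack-contents {suc m} A B =
  trans (cong (tabulate (A zero) ++_) (stack-contents (tail A) B))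
        (sym (++-assoc (tabulate (A zero)) _ _))

infixr 4 _above_ _beside_

_above_ : ∀ {m m′ n k k′ L L′} → Tile m n k L → Tile m′ n k′ L′ →
          Tile (m + m′) n (k + k′) (L ++ L′)
_above_ {k = k} {k′} {L} {L′} T U = record
  { cells      = stack (cells T) (cells U)
  ; rowSums    = stack-rowSum (cells T) (cells U) (rowSums T) (rowSums U)
  ; columnSums = λ j → trans (stack-columnSum (cells T) (cells U) j)
                           (cong₂ ℤ._+_ (columnSums T j) (columnSums U j))
  ; contents-↭ = ↭-trans (↭-reflexive (stack-contents (cells T) (cells U)))
                         (↭-trans (++⁺ (contents-↭ T) (contents-↭ U)) (values-++ k L k′ L′))
  }

-- The first column of `A` is the first row of its transpose, so peeling it off drives the induction
-- in `contents-transpose`.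
contents-firstColumn : ∀ {m n} (A : Array m (suc n)) →
  contents A ↭ tabulate (λ i → A i zero) ++ contents (λ i j → A i (suc j))
contents-firstColumn {zero}  A = refl
contents-firstColumn {suc m} A = prep (A zero zero)
  (↭-trans (++⁺ˡ (tabulate (λ j → A zero (suc j))) (contents-firstColumn (tail A)))
           (shifts (tabulate (λ j → A zero (suc j))) (tabulate (λ i → A (suc i) zero))))

contents-noColumns : ∀ m (A : Array m 0) → contents A ≡ []
contents-noColumns zero    A = refl
contents-noColumns (suc m) A = contents-noColumns m (tail A)

contents-transpose : ∀ {m n} (A : Array m n) → contents (transpose A) ↭ contents A
contents-transpose {n = zero}  A = ↭-sym (↭-reflexive (contents-noColumns _ A))
contents-transpose {n = suc n} A =
  ↭-trans (++⁺ˡ (tabulate (λ i → A i zero)) (contents-transpose (λ i j → A i (suc j))))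
          (↭-sym (contents-firstColumn A))

flip : ∀ {m n k L} → Tile m n k L → Tile n m k L
flip T = record
  { cells      = transpose (cells T)
  ; rowSums    = columnSums T
  ; columnSums = rowSums T
  ; contents-↭ = ↭-trans (contents-transpose (cells T)) (contents-↭ T)
  }

_beside_ : ∀ {m n n′ k k′ L L′} → Tile m n k L → Tile m n′ k′ L′ →
           Tile m (n + n′) (k + k′) (L ++ L′)
T beside U = flip (flip T above flip U)

noRows : ∀ n → Tile 0 n 0 []
noRows n = record { cells = λ () ; rowSums = λ () ; columnSums = λ _ → refl ; contents-↭ = refl }

-- Explicit tiles of small size

table : ∀ {m n} → Vec (Vec ℤ n) m → Array m n
table M i j = Vec.lookup (Vec.lookup M i) j

cancel : ∀ x → x ℤ.+ (- x ℤ.+ 0ℤ) ≡ 0ℤ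
cancel = ℤ-Solver.solve-∀

cancel′ : ∀ x → - x ℤ.+ (x ℤ.+ 0ℤ) ≡ 0ℤ
cancel′ = ℤ-Solver.solve-∀

-- Rows are cancelling pairs, and the relation between `a`, `b` and `c` makes both columns vanish.
-- Here and in the next tiles sums are written with integer addition, which reduces to `+ (a + b)`
-- but remains visible to the ring solver.
schurTile : ∀ {a b c} → a + b ≡ c → Tile 3 2 0 (a ∷ b ∷ c ∷ [])
schurTile {a} {b} refl = record
  { cells      = table
      ( (  + a           ∷ - (+ a)        ∷ [])
      ∷ (  + b           ∷ - (+ b)        ∷ [])
      ∷ (- (+ a ℤ.+ + b) ∷   + a ℤ.+ + b  ∷ [])
      ∷ [])
  ; rowSums    = λ { zero → cancel (+ a) ; (suc zero) → cancel (+ b)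
                   ; (suc (suc zero)) → cancel′ (+ a ℤ.+ + b) }
  ; columnSums = λ { zero → left (+ a) (+ b) ; (suc zero) → right (+ a) (+ b) }
  ; contents-↭ = prep _ (prep _ (prep _ (prep _ (↭.swap _ _ refl))))
  }
  where
  left : ∀ x y → x ℤ.+ (y ℤ.+ (- (x ℤ.+ y) ℤ.+ 0ℤ)) ≡ 0ℤ
  left = ℤ-Solver.solve-∀
  right : ∀ x y → - x ℤ.+ (- y ℤ.+ (x ℤ.+ y ℤ.+ 0ℤ)) ≡ 0ℤ
  right = ℤ-Solver.solve-∀

quadTile : ∀ a → Tile 2 4 0 (a ∷ 1 + a ∷ 2 + a ∷ 3 + a ∷ [])
quadTile a = record
  { cells      = table
      ( (  + a   ∷ - (+ 1 ℤ.+ + a) ∷ - (+ 2 ℤ.+ + a) ∷  (+ 3 ℤ.+ + a) ∷ [])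
      ∷ (- (+ a) ∷   (+ 1 ℤ.+ + a) ∷   (+ 2 ℤ.+ + a) ∷ - (+ 3 ℤ.+ + a) ∷ [])
      ∷ [])
  ; rowSums    = λ { zero → row₀ (+ a) ; (suc zero) → row₁ (+ a) }
  ; columnSums = λ { zero → cancel (+ a) ; (suc zero) → cancel′ (+ 1 ℤ.+ + a)
                   ; (suc (suc zero)) → cancel′ (+ 2 ℤ.+ + a) ; (suc (suc (suc zero))) → cancel (+ 3 ℤ.+ + a) }
  ; contents-↭ = rearrange
      ((+ a ∷ []) ∷ (- (+ a) ∷ []) ∷ (+ 1 ℤ.+ + a ∷ []) ∷ (- (+ 1 ℤ.+ + a) ∷ [])
       ∷ (+ 2 ℤ.+ + a ∷ []) ∷ (- (+ 2 ℤ.+ + a) ∷ []) ∷ (+ 3 ℤ.+ + a ∷ []) ∷ (- (+ 3 ℤ.+ + a) ∷ []) ∷ [])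
      -- The blocks are the signed values in the order of `signed`; the first index list reads the
      -- array row by row.
      (0 ∷ 3 ∷ 5 ∷ 6 ∷ 1 ∷ 2 ∷ 4 ∷ 7 ∷ []) (upTo 8) refl
  }
  where
  row₀ : ∀ x → x ℤ.+ (- (+ 1 ℤ.+ x) ℤ.+ (- (+ 2 ℤ.+ x) ℤ.+ (+ 3 ℤ.+ x ℤ.+ 0ℤ))) ≡ 0ℤ
  row₀ = ℤ-Solver.solve-∀
  row₁ : ∀ x → - x ℤ.+ (+ 1 ℤ.+ x ℤ.+ (+ 2 ℤ.+ x ℤ.+ (- (+ 3 ℤ.+ x) ℤ.+ 0ℤ))) ≡ 0ℤ
  row₁ = ℤ-Solver.solve-∀

signedBlocks : List ℕ → List (List ℤ)
signedBlocks = concatMap λ k → (+ k ∷ []) ∷ (- (+ k) ∷ []) ∷ []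

-- A half turn negates the array, so the middle row and column vanish automatically. The first row
-- needs x + y = s and the first column w + x = y.
core33 : ∀ {x w y s} → w + x ≡ y → x + y ≡ s → Tile 3 3 1 (x ∷ w ∷ y ∷ s ∷ [])
core33 {x} {w} refl refl = record
  { cells      = table
      ( (  p ∷ - u ∷   r ∷ [])
      ∷ (  q ∷  0ℤ ∷ - q ∷ [])
      ∷ (- r ∷   u ∷ - p ∷ [])
      ∷ [])
  ; rowSums    = λ { zero → row₀ p q ; (suc zero) → row₁ q ; (suc (suc zero)) → row₂ p q }
  ; columnSums = λ { zero → col₀ p q ; (suc zero) → col₁ u ; (suc (suc zero)) → col₂ p q }
  ; contents-↭ = rearrange ((0ℤ ∷ []) ∷ signedBlocks (x ∷ w ∷ w + x ∷ x + (w + x) ∷ []))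
      (1 ∷ 8 ∷ 5 ∷ 3 ∷ 0 ∷ 4 ∷ 6 ∷ 7 ∷ 2 ∷ []) (upTo 9) refl
  }
  where
  p = + x
  q = + w
  r = q ℤ.+ p
  u = p ℤ.+ (q ℤ.+ p)
  row₀ : ∀ x w → x ℤ.+ (- (x ℤ.+ (w ℤ.+ x)) ℤ.+ (w ℤ.+ x ℤ.+ 0ℤ)) ≡ 0ℤ
  row₀ = ℤ-Solver.solve-∀
  row₁ : ∀ w → w ℤ.+ (0ℤ ℤ.+ (- w ℤ.+ 0ℤ)) ≡ 0ℤ
  row₁ = ℤ-Solver.solve-∀
  row₂ : ∀ x w → - (w ℤ.+ x) ℤ.+ (x ℤ.+ (w ℤ.+ x) ℤ.+ (- x ℤ.+ 0ℤ)) ≡ 0ℤ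
  row₂ = ℤ-Solver.solve-∀
  col₀ : ∀ x w → x ℤ.+ (w ℤ.+ (- (w ℤ.+ x) ℤ.+ 0ℤ)) ≡ 0ℤ
  col₀ = ℤ-Solver.solve-∀
  col₁ : ∀ s → - s ℤ.+ (0ℤ ℤ.+ (s ℤ.+ 0ℤ)) ≡ 0ℤ
  col₁ = ℤ-Solver.solve-∀
  col₂ : ∀ x w → w ℤ.+ x ℤ.+ (- w ℤ.+ (- x ℤ.+ 0ℤ)) ≡ 0ℤ
  col₂ = ℤ-Solver.solve-∀

-- Every row consists of two cancelling pairs. The columns express b + e = f, a + c = e, c + d = f
-- and a + b = d, of which the third follows from the other three.
core34 : ∀ {a b c d e f} → a + b ≡ d → a + c ≡ e → b + e ≡ f →
         Tile 3 4 0 (a ∷ b ∷ c ∷ d ∷ e ∷ f ∷ [])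
core34 {a} {b} {c} refl refl refl = record
  { cells      = table
      ( (  E ∷ - E ∷ - D ∷   D ∷ [])
      ∷ (- F ∷   A ∷   F ∷ - A ∷ [])
      ∷ (  B ∷   C ∷ - C ∷ - B ∷ [])
      ∷ [])
  ; rowSums    = λ { zero → row₀ E D ; (suc zero) → row₁ F A ; (suc (suc zero)) → row₂ B C }
  ; columnSums = λ { zero → col₀ A B C ; (suc zero) → col₁ A C
                   ; (suc (suc zero)) → col₂ A B C ; (suc (suc (suc zero))) → col₃ A B }
  ; contents-↭ = rearrange (signedBlocks (a ∷ b ∷ c ∷ a + b ∷ a + c ∷ b + (a + c) ∷ []))
      (8 ∷ 9 ∷ 7 ∷ 6 ∷ 11 ∷ 0 ∷ 10 ∷ 1 ∷ 2 ∷ 4 ∷ 5 ∷ 3 ∷ [])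
      (upTo 12) refl
  }
  where
  A = + a
  B = + b
  C = + c
  D = A ℤ.+ B
  E = A ℤ.+ C
  F = B ℤ.+ (A ℤ.+ C)
  row₀ : ∀ e d → e ℤ.+ (- e ℤ.+ (- d ℤ.+ (d ℤ.+ 0ℤ))) ≡ 0ℤ
  row₀ = ℤ-Solver.solve-∀
  row₁ : ∀ f a → - f ℤ.+ (a ℤ.+ (f ℤ.+ (- a ℤ.+ 0ℤ))) ≡ 0ℤ
  row₁ = ℤ-Solver.solve-∀
  row₂ : ∀ b c → b ℤ.+ (c ℤ.+ (- c ℤ.+ (- b ℤ.+ 0ℤ))) ≡ 0ℤ
  row₂ = ℤ-Solver.solve-∀
  col₀ : ∀ a b c → a ℤ.+ c ℤ.+ (- (b ℤ.+ (a ℤ.+ c)) ℤ.+ (b ℤ.+ 0ℤ)) ≡ 0ℤ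
  col₀ = ℤ-Solver.solve-∀
  col₁ : ∀ a c → - (a ℤ.+ c) ℤ.+ (a ℤ.+ (c ℤ.+ 0ℤ)) ≡ 0ℤ
  col₁ = ℤ-Solver.solve-∀
  col₂ : ∀ a b c → - (a ℤ.+ b) ℤ.+ (b ℤ.+ (a ℤ.+ c) ℤ.+ (- c ℤ.+ 0ℤ)) ≡ 0ℤ
  col₂ = ℤ-Solver.solve-∀
  col₃ : ∀ a b → a ℤ.+ b ℤ.+ (- a ℤ.+ (- b ℤ.+ 0ℤ)) ≡ 0ℤ
  col₃ = ℤ-Solver.solve-∀

interval : ℕ → ℕ → List ℕ
interval a zero    = []
interval a (suc l) = a ∷ interval (suc a) l

interval-++ : ∀ a l l′ → interval a (l + l′) ≡ interval a l ++ interval (a + l) l′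
interval-++ a zero    l′ = cong (λ b → interval b l′) (sym (ℕ.+-identityʳ a))
interval-++ a (suc l) l′ = cong (a ∷_)
  (trans (interval-++ (suc a) l l′)
         (cong (λ b → interval (suc a) l ++ interval b l′) (sym (ℕ.+-suc a l))))

tile35 : Tile 3 5 1 (interval 1 7)
tile35 = record
  { cells      = A
  ; rowSums    = toWitness {a? = all? λ i → sum (A i) ℤ.≟ 0ℤ} _
  ; columnSums = toWitness {a? = all? λ j → sum (transpose A j) ℤ.≟ 0ℤ} _
  ; contents-↭ = rearrange ((0ℤ ∷ []) ∷ signedBlocks (interval 1 7))
      (13 ∷ 11 ∷ 6 ∷ 12 ∷ 8 ∷ 14 ∷ 10 ∷ 9 ∷ 7 ∷ 5 ∷ 0 ∷ 2 ∷ 4 ∷ 3 ∷ 1 ∷ [])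
      (upTo 15) refl
  }
  where
  A : Array 3 5
  A = table
    ( (  + 7 ∷   + 6 ∷ - + 3 ∷ - + 6 ∷ - + 4 ∷ [])
    ∷ (- + 7 ∷ - + 5 ∷   + 5 ∷   + 4 ∷   + 3 ∷ [])
    ∷ (  + 0 ∷ - + 1 ∷ - + 2 ∷   + 2 ∷   + 1 ∷ [])
    ∷ [])

-- As in `core33`, a half turn negates the array.
tile55 : Tile 5 5 1 (interval 1 12)
tile55 = record
  { cells      = A
  ; rowSums    = toWitness {a? = all? λ i → sum (A i) ℤ.≟ 0ℤ} _
  ; columnSums = toWitness {a? = all? λ j → sum (transpose A j) ℤ.≟ 0ℤ} _
  ; contents-↭ = rearrange ((0ℤ ∷ []) ∷ signedBlocks (interval 1 12))
      (7 ∷ 21 ∷ 24 ∷ 10 ∷ 3 ∷ 19 ∷ 16 ∷ 12 ∷ 1 ∷ 5 ∷ 18 ∷ 14 ∷ 0 ∷ 13 ∷ 17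
       ∷ 6 ∷ 2 ∷ 11 ∷ 15 ∷ 20 ∷ 4 ∷ 9 ∷ 23 ∷ 22 ∷ 8 ∷ [])
      (upTo 25) refl
  }
  where
  A : Array 5 5
  A = table
    ( (  + 4 ∷  + 11 ∷ - + 12 ∷ - + 5 ∷    + 2 ∷ [])
    ∷ ( + 10 ∷ - + 8 ∷  - + 6 ∷   + 1 ∷    + 3 ∷ [])
    ∷ (- + 9 ∷ - + 7 ∷    + 0 ∷   + 7 ∷    + 9 ∷ [])
    ∷ (- + 3 ∷ - + 1 ∷    + 6 ∷   + 8 ∷ - + 10 ∷ [])
    ∷ (- + 2 ∷   + 5 ∷   + 12 ∷ - + 11 ∷ - + 4 ∷ [])
    ∷ [])

-- Covering an interval by a core and triples

data Triples : ℕ → List ℕ → Set where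
  []  : Triples 0 []
  _∷_ : ∀ {t a b c L} → a + b ≡ c → Triples t L → Triples (suc t) (a ∷ b ∷ c ∷ L)

triples-++ : ∀ {s t L L′} → Triples s L → Triples t L′ → Triples (s + t) (L ++ L′)
triples-++ []      q = q
triples-++ (e ∷ p) q = e ∷ triples-++ p q

-- Distributes the triples of a single cover over the strips and the remaining rectangle.
triples-split : ∀ s {t L} → Triples (s + t) L →
                ∃₂ λ L₁ L₂ → L ≡ L₁ ++ L₂ × Triples s L₁ × Triples t L₂
triples-split zero    p       = _ , _ , refl , [] , p
triples-split (suc s) (e ∷ p) with triples-split s p
... | L₁ , L₂ , refl , q , r = _ , L₂ , refl , e ∷ q , r

steps : ℕ → ℕ → List ℕ
steps d zero    = []
steps d (suc n) = d ∷ steps (2 + d) n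

chain : ℕ → ℕ → ℕ → List ℕ
chain d p zero    = []
chain d p (suc n) = d ∷ p + n ∷ d + (p + n) ∷ chain (2 + d) p n

chain-triples : ∀ d p n → Triples n (chain d p n)
chain-triples d p zero    = []
chain-triples d p (suc n) = refl ∷ chain-triples (2 + d) p n

-- From one triple to the next the difference grows by 2, the smaller end drops by 1 and the larger
-- end rises by 1. So the smaller ends run down from p + n - 1 to p and the larger ones up from d +
-- p + n; taking `suc d` as the first difference avoids a subtraction in that bound.
chain-↭ : ∀ d p n → chain (suc d) p n ↭ steps (suc d) n ++ interval p n ++ interval (d + (p + n)) n
chain-↭ d p zero    = refl
chain-↭ d p (suc n) = prep (suc d) (begin
  p + n ∷ e ∷ chain (3 + d) p n
    ↭⟨ prep _ (prep _ (chain-↭ (2 + d) p n)) ⟩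
  p + n ∷ e ∷ S ++ (interval p n ++ T)
    ↭⟨ rearrange ((p + n ∷ []) ∷ (e ∷ []) ∷ S ∷ interval p n ∷ T ∷ [])
                 (upTo 5) (2 ∷ 3 ∷ 0 ∷ 1 ∷ 4 ∷ []) refl ⟩
  S ++ (interval p n ++ (p + n ∷ e ∷ T))
    ≡⟨ cong (S ++_) (++-assoc (interval p n) (p + n ∷ []) _) ⟨
  S ++ ((interval p n ++ (p + n ∷ [])) ++ (e ∷ T))
    ≡⟨ cong₂ (λ L b → S ++ (L ++ interval b (suc n)))
         (trans (sym (interval-++ p n 1)) (cong (interval p) (ℕ.+-comm n 1)))
         (ends d p n) ⟩
  S ++ (interval p (suc n) ++ interval (d + (p + suc n)) (suc n)) ∎)
  where
  open PermutationReasoning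
  e = suc d + (p + n)
  S = steps (3 + d) n
  T = interval (suc e) n
  ends : ∀ d p n → suc d + (p + n) ≡ d + (p + suc n)
  ends = ℕ-Solver.solve-∀

steps-↭ : ∀ d n → steps d n ++ steps (suc d) n ↭ interval d (2 * n)
steps-↭ d zero    = refl
steps-↭ d (suc n) = prep d (begin
  steps (2 + d) n ++ (suc d ∷ steps (3 + d) n) ↭⟨ shift (suc d) (steps (2 + d) n) _ ⟩
  suc d ∷ steps (2 + d) n ++ steps (3 + d) n   ↭⟨ prep (suc d) (steps-↭ (2 + d) n) ⟩
  suc d ∷ interval (2 + d) (2 * n)             ≡⟨ cong (interval (suc d)) (ℕ.+-suc n (n + 0)) ⟨
  interval (suc d) (n + suc (n + 0))           ∎)
  where open PermutationReasoning

steps-∷ʳ : ∀ d n → steps d n ++ (d + 2 * n ∷ []) ≡ steps d (suc n)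
steps-∷ʳ d zero    = cong (_∷ []) (ℕ.+-identityʳ d)
steps-∷ʳ d (suc n) = cong (d ∷_)
  (trans (cong (λ e → steps (2 + d) n ++ (e ∷ [])) (last d n)) (steps-∷ʳ (2 + d) n))
  where
  last : ∀ d n → d + 2 * suc n ≡ 2 + d + 2 * n
  last = ℕ-Solver.solve-∀

-- A list running through a, ..., b - 1. Exposing the end points lets adjacent pieces be glued
-- without computing lengths; the total length is compared only once, in `span-≡`.
record Span (a : ℕ) (L : List ℕ) (b : ℕ) : Set where
  constructor span
  field
    size   : ℕ
    end    : a + size ≡ b
    listed : L ≡ interval a size

infixr 5 _⋯_ _◂_

_⋯_ : ∀ {a b c L L′} → Span a L b → Span b L′ c → Span a (L ++ L′) c
_⋯_ {a} (span l refl refl) (span l′ refl refl) =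
  span (l + l′) (sym (ℕ.+-assoc a l l′)) (sym (interval-++ a l l′))

_◂_ : ∀ a {b L} → Span (suc a) L b → Span a (a ∷ L) b
a ◂ span l refl refl = span (suc l) (ℕ.+-suc a l) refl

nil : ∀ {a} → Span a [] a
nil = span 0 (ℕ.+-identityʳ _) refl

fill : ∀ {a} l → Span a (interval a l) (a + l)
fill l = span l refl refl

-- All numbers in a cover below are of the form c + k n; consecutive blocks of n of them raise k by one.
seg : ℕ → ℕ → ℕ → List ℕ
seg c k n = interval (c + k * n) n

segment : ∀ c k n → Span (c + k * n) (seg c k n) (c + suc k * n)
segment c k n = span n (eq c k n) refl
  where
  eq : ∀ c k n → c + k * n + n ≡ c + suc k * n
  eq = ℕ-Solver.solve-∀

linked : ℕ → ℕ → ℕ → ℕ → List ℕ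
linked d c k n = chain (suc d) (c + k * n) n

-- The smaller ends fill block k and the larger ends block k + 1, with `d` added to the constant.
linked-↭ : ∀ d c k n → linked d c k n ↭ steps (suc d) n ++ seg c k n ++ seg (d + c) (suc k) n
linked-↭ d c k n = ↭-trans (chain-↭ d (c + k * n) n)
  (↭-reflexive (cong (λ b → steps (suc d) n ++ seg c k n ++ interval b n) (eq d c k n)))
  where
  eq : ∀ d c k n → d + (c + k * n + n) ≡ d + c + suc k * n
  eq = ℕ-Solver.solve-∀

span-≡ : ∀ {L a b} M → Span a L b → a + M ≡ b → L ≡ interval a M
span-≡ {a = a} M (span l e refl) f =
  cong (interval a) (ℕ.+-cancelˡ-≡ a l M (trans e (sym f)))

-- In each family the two chains have k = 2 and k = 4. Up to bounded shifts their pairs fill the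
-- numbers from 2n to 6n, while their differences, of opposite parity, fill those below 2n.
linked²-↭ : ∀ d c k d′ c′ k′ n →
  linked d c k n ++ linked d′ c′ k′ n ↭
  steps (suc d) n ++ seg c k n ++ seg (d + c) (suc k) n ++
  steps (suc d′) n ++ seg c′ k′ n ++ seg (d′ + c′) (suc k′) n
linked²-↭ d c k d′ c′ k′ n = ↭-trans
  (++⁺ (linked-↭ d c k n) (linked-↭ d′ c′ k′ n))
  (↭-reflexive (trans (++-assoc (steps (suc d) n) _ _)
                      (cong (steps (suc d) n ++_) (++-assoc (seg c k n) _ _))))

linked²-triples : ∀ d c k d′ c′ k′ n →
  Triples (n + n) (linked d c k n ++ linked d′ c′ k′ n)
linked²-triples d c k d′ c′ k′ n = triples-++ (chain-triples (suc d) _ n) (chain-triples (suc d′) _ n)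

steps-pair : ∀ d n R → steps d n ++ steps (suc d) n ++ R ↭ interval d (2 * n) ++ R
steps-pair d n R = ↭-trans (↭-reflexive (sym (++-assoc (steps d n) _ R))) (++⁺ʳ R (steps-↭ d n))

-- Differences starting at d and at d + 3 miss only d + 1 and d + 2n of the interval; these two come
-- from the core or the extra triples.
steps-gap : ∀ d n R →
  steps d n ++ (d + 2 * n ∷ suc d ∷ steps (3 + d) n ++ R) ↭ interval d (2 + 2 * n) ++ R
steps-gap d n R = begin
  steps d n ++ ((d + 2 * n ∷ []) ++ (steps (suc d) (suc n) ++ R))
    ≡⟨ ++-assoc (steps d n) _ _ ⟨
  (steps d n ++ (d + 2 * n ∷ [])) ++ (steps (suc d) (suc n) ++ R)
    ≡⟨ cong (_++ (steps (suc d) (suc n) ++ R)) (steps-∷ʳ d n) ⟩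
  steps d (suc n) ++ (steps (suc d) (suc n) ++ R)
    ↭⟨ steps-pair d (suc n) R ⟩
  interval d (2 * suc n) ++ R
    ≡⟨ cong (λ l → interval d l ++ R) (ℕ.*-suc 2 n) ⟩
  interval d (2 + 2 * n) ++ R ∎
  where open PermutationReasoning

-- `w` is the width of the core, `k` its number of zeros and `e` its number of absolute values; `t`
-- counts the triples. The core values are not fixed by these parameters, as they vary with `t`.
record Cover (w k e t : ℕ) : Set where
  constructor cover
  field
    {coreValues tripleValues} : List ℕ
    core    : Tile 3 w k coreValues
    triples : Triples t tripleValues
    total   : coreValues ++ tripleValues ↭ interval 1 (e + 3 * t)

-- In the four families the two chains fill most of the interval; the constants of the core and of the
-- other triples were found by searching for a way to use exactly the numbers which are left over.
cover33-even : ∀ n → Cover 3 1 4 (2 + (n + n))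
cover33-even n = cover
  (core33 {x = 1} {w = 7 + 5 * n} (ℕ.+-comm _ 1) refl)
  (_∷_ {a = 4 + 2 * n} {6 + 3 * n} (e₁ n)
  ( _∷_ {a = 3} {2 + 2 * n} refl
  ( linked²-triples 1 6 2 4 7 4 n)))
  (begin
    vs ++ linked 1 6 2 n ++ linked 4 7 4 n
        ↭⟨ ++⁺ˡ vs (linked²-↭ 1 6 2 4 7 4 n) ⟩
    -- Indices 0 to 9 are the single numbers in `vs`, 10 to 15 the six blocks. The new order is
    -- increasing, except that the two runs of differences still have to be interleaved, which the
    -- next step does.
    _   ↭⟨ rearrange (map (_∷ []) vs
                      ++ steps 2 n ∷ seg 6 2 n ∷ seg 7 3 n
                       ∷ steps 5 n ∷ seg 7 4 n ∷ seg 11 5 n ∷ [])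
             (upTo 16)
             (0 ∷ 10 ∷ 8 ∷ 7 ∷ 13 ∷ 4 ∷ 9 ∷ 11 ∷ 5 ∷ 12 ∷ 14 ∷ 1 ∷ 2 ∷ 3 ∷ 6 ∷ 15 ∷ []) refl ⟩
    _   ↭⟨ prep _ (steps-gap 2 n _) ⟩
    -- The single numbers plug the gaps between consecutive segments. All end points have the form c
    -- + k n with literal c and k, so they match by computation and determine the underscores.
    _   ≡⟨ span-≡ _ (1 ◂ fill (2 + 2 * n) ⋯ _ ◂ _ ◂ segment 6 2 n
                    ⋯ _ ◂ segment 7 3 n ⋯ segment 7 4 n
                    ⋯ _ ◂ _ ◂ _ ◂ _ ◂ segment 11 5 n)
                    (e₂ n) ⟩
    interval 1 (4 + 3 * (2 + (n + n))) ∎)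
  where
  open PermutationReasoning
  vs : List ℕ
  vs = 1 ∷ 7 + 5 * n ∷ 8 + 5 * n ∷ 9 + 5 * n ∷ 4 + 2 * n
     ∷ 6 + 3 * n ∷ 10 + 5 * n ∷ 3 ∷ 2 + 2 * n ∷ 5 + 2 * n ∷ []
  e₁ : ∀ n → 4 + 2 * n + (6 + 3 * n) ≡ 10 + 5 * n
  e₁ = ℕ-Solver.solve-∀
  e₂ : ∀ n → 1 + (4 + 3 * (2 + (n + n))) ≡ 11 + 6 * n
  e₂ = ℕ-Solver.solve-∀

cover33-odd : ∀ n → Cover 3 1 4 (3 + (n + n))
cover33-odd n = cover
  (core33 {x = 1} {w = 9 + 5 * n} (ℕ.+-comm _ 1) refl)
  (_∷_ {a = 6 + 3 * n} {7 + 3 * n} (e₁ n)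
  ( _∷_ {a = 4 + 2 * n} {8 + 4 * n} (e₂ n)
  ( _∷_ {a = 2} {3 + 2 * n} refl
  ( linked²-triples 2 6 2 3 9 4 n))))
  (begin
    vs ++ linked 2 6 2 n ++ linked 3 9 4 n
        ↭⟨ ++⁺ˡ vs (linked²-↭ 2 6 2 3 9 4 n) ⟩
    _   ↭⟨ rearrange (map (_∷ []) vs
                      ++ steps 3 n ∷ seg 6 2 n ∷ seg 8 3 n
                       ∷ steps 4 n ∷ seg 9 4 n ∷ seg 12 5 n ∷ [])
             (upTo 19)
             (0 ∷ 10 ∷ 13 ∷ 16 ∷ 11 ∷ 7 ∷ 12 ∷ 14 ∷ 4 ∷ 5 ∷ 15 ∷ 8 ∷ 17 ∷ 1 ∷ 2 ∷ 3 ∷ 18 ∷ 9 ∷ 6 ∷ []) refl ⟩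
    _   ↭⟨ prep _ (prep _ (steps-pair 3 n _)) ⟩
    _   ≡⟨ span-≡ _ (1 ◂ 2 ◂ fill (2 * n) ⋯ _ ◂ _ ◂ _ ◂ segment 6 2 n
                    ⋯ _ ◂ _ ◂ segment 8 3 n ⋯ _ ◂ segment 9 4 n
                    ⋯ _ ◂ _ ◂ _ ◂ segment 12 5 n ⋯ _ ◂ _ ◂ nil)
                    (e₃ n) ⟩
    interval 1 (4 + 3 * (3 + (n + n))) ∎)
  where
  open PermutationReasoning
  vs : List ℕ
  vs = 1 ∷ 9 + 5 * n ∷ 10 + 5 * n ∷ 11 + 5 * n ∷ 6 + 3 * n
     ∷ 7 + 3 * n ∷ 13 + 6 * n ∷ 4 + 2 * n ∷ 8 + 4 * n ∷ 12 + 6 * n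
     ∷ 2 ∷ 3 + 2 * n ∷ 5 + 2 * n ∷ []
  e₁ : ∀ n → 6 + 3 * n + (7 + 3 * n) ≡ 13 + 6 * n
  e₁ = ℕ-Solver.solve-∀
  e₂ : ∀ n → 4 + 2 * n + (8 + 4 * n) ≡ 12 + 6 * n
  e₂ = ℕ-Solver.solve-∀
  e₃ : ∀ n → 1 + (4 + 3 * (3 + (n + n))) ≡ 14 + 6 * n
  e₃ = ℕ-Solver.solve-∀

cover34-even : ∀ n → Cover 4 0 6 (2 + (n + n))
cover34-even n = cover
  (core34 {a = 1} {2} {8 + 5 * n} refl refl refl)
  (_∷_ {a = 5 + 3 * n} {7 + 3 * n} (e₁ n)
  ( _∷_ {a = 4 + 2 * n} {6 + 3 * n} (e₂ n)
  ( linked²-triples 3 5 2 4 8 4 n)))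
  (begin
    vs ++ linked 3 5 2 n ++ linked 4 8 4 n
        ↭⟨ ++⁺ˡ vs (linked²-↭ 3 5 2 4 8 4 n) ⟩
    _   ↭⟨ rearrange (map (_∷ []) vs
                      ++ steps 4 n ∷ seg 5 2 n ∷ seg 8 3 n
                       ∷ steps 5 n ∷ seg 8 4 n ∷ seg 12 5 n ∷ [])
             (upTo 18)
             (0 ∷ 1 ∷ 3 ∷ 12 ∷ 15 ∷ 9 ∷ 13 ∷ 6 ∷ 10 ∷ 7 ∷ 14 ∷ 16 ∷ 2 ∷ 4 ∷ 11 ∷ 5 ∷ 17 ∷ 8 ∷ []) refl ⟩
    _   ↭⟨ prep _ (prep _ (prep _ (steps-pair 4 n _))) ⟩
    _   ≡⟨ span-≡ _ (1 ◂ 2 ◂ 3 ◂ fill (2 * n) ⋯ _ ◂ segment 5 2 n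
                    ⋯ _ ◂ _ ◂ _ ◂ segment 8 3 n ⋯ segment 8 4 n
                    ⋯ _ ◂ _ ◂ _ ◂ _ ◂ segment 12 5 n ⋯ _ ◂ nil)
                    (e₃ n) ⟩
    interval 1 (6 + 3 * (2 + (n + n))) ∎)
  where
  open PermutationReasoning
  vs : List ℕ
  vs = 1 ∷ 2 ∷ 8 + 5 * n ∷ 3 ∷ 9 + 5 * n
     ∷ 11 + 5 * n ∷ 5 + 3 * n ∷ 7 + 3 * n ∷ 12 + 6 * n ∷ 4 + 2 * n
     ∷ 6 + 3 * n ∷ 10 + 5 * n ∷ []
  e₁ : ∀ n → 5 + 3 * n + (7 + 3 * n) ≡ 12 + 6 * n
  e₁ = ℕ-Solver.solve-∀
  e₂ : ∀ n → 4 + 2 * n + (6 + 3 * n) ≡ 10 + 5 * n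
  e₂ = ℕ-Solver.solve-∀
  e₃ : ∀ n → 1 + (6 + 3 * (2 + (n + n))) ≡ 13 + 6 * n
  e₃ = ℕ-Solver.solve-∀

cover34-odd : ∀ n → Cover 4 0 6 (3 + (n + n))
cover34-odd n = cover
  (core34 {a = 5 + 3 * n} {3} {7 + 3 * n} (ℕ.+-comm _ 3) (e₁ n) refl)
  (_∷_ {a = 1} {13 + 6 * n} refl
  ( _∷_ {a = 2 + 2 * n} {9 + 4 * n} (e₂ n)
  ( _∷_ {a = 4 + 2 * n} {6 + 3 * n} (e₃ n)
  ( linked²-triples 4 5 2 1 10 4 n))))
  (begin
    vs ++ linked 4 5 2 n ++ linked 1 10 4 n
        ↭⟨ ++⁺ˡ vs (linked²-↭ 4 5 2 1 10 4 n) ⟩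
    _   ↭⟨ rearrange (map (_∷ []) vs
                      ++ steps 5 n ∷ seg 5 2 n ∷ seg 9 3 n
                       ∷ steps 2 n ∷ seg 10 4 n ∷ seg 11 5 n ∷ [])
             (upTo 21)
             (6 ∷ 18 ∷ 9 ∷ 1 ∷ 15 ∷ 12 ∷ 16 ∷ 0 ∷ 13 ∷ 2 ∷ 3 ∷ 17 ∷ 10 ∷ 19 ∷ 14 ∷ 20 ∷ 11 ∷ 4 ∷ 7 ∷ 8 ∷ 5 ∷ []) refl ⟩
    _   ↭⟨ prep _ (steps-gap 2 n _) ⟩
    _   ≡⟨ span-≡ _ (1 ◂ fill (2 + 2 * n) ⋯ _ ◂ segment 5 2 n
                    ⋯ _ ◂ _ ◂ _ ◂ _ ◂ segment 9 3 n ⋯ _ ◂ segment 10 4 n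
                    ⋯ _ ◂ segment 11 5 n ⋯ _ ◂ _ ◂ _ ◂ _ ◂ _ ◂ nil)
                    (e₄ n) ⟩
    interval 1 (6 + 3 * (3 + (n + n))) ∎)
  where
  open PermutationReasoning
  vs : List ℕ
  vs = 5 + 3 * n ∷ 3 ∷ 7 + 3 * n ∷ 8 + 3 * n ∷ 12 + 6 * n
     ∷ 15 + 6 * n ∷ 1 ∷ 13 + 6 * n ∷ 14 + 6 * n ∷ 2 + 2 * n
     ∷ 9 + 4 * n ∷ 11 + 6 * n ∷ 4 + 2 * n ∷ 6 + 3 * n ∷ 10 + 5 * n ∷ []
  e₁ : ∀ n → 5 + 3 * n + (7 + 3 * n) ≡ 12 + 6 * n
  e₁ = ℕ-Solver.solve-∀
  e₂ : ∀ n → 2 + 2 * n + (9 + 4 * n) ≡ 11 + 6 * n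
  e₂ = ℕ-Solver.solve-∀
  e₃ : ∀ n → 4 + 2 * n + (6 + 3 * n) ≡ 10 + 5 * n
  e₃ = ℕ-Solver.solve-∀
  e₄ : ∀ n → 1 + (6 + 3 * (3 + (n + n))) ≡ 16 + 6 * n
  e₄ = ℕ-Solver.solve-∀

data Parity : ℕ → Set where
  even : ∀ k → Parity (k * 2)
  odd  : ∀ k → Parity (1 + k * 2)

parity : ∀ n → Parity n
parity zero    = even 0
parity (suc n) with parity n
... | even k = odd k
... | odd  k = even (suc k)

n+n≡n*2 : ∀ n → n + n ≡ n * 2
n+n≡n*2 = ℕ-Solver.solve-∀

-- For t = 1 no such cover of 1, …, 7 exists, which is why 3 × 5 arrays need tile35.
cover33 : ∀ t → t ≢ 1 → Cover 3 1 4 t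
cover33 t t≢1 with parity t
... | even 0       = cover (core33 {x = 1} {2} refl refl) [] refl
... | even (suc n) = subst (λ s → Cover 3 1 4 (2 + s)) (n+n≡n*2 n) (cover33-even n)
... | odd 0        = contradiction refl t≢1
... | odd (suc n)  = subst (λ s → Cover 3 1 4 (3 + s)) (n+n≡n*2 n) (cover33-odd n)

cover34 : ∀ t → Cover 4 0 6 t
cover34 t with parity t
... | even 0       = cover (core34 {a = 3} {1} {2} refl refl refl) []
  -- The list of blocks starts at 0 so that each index is the number it selects.
  (rearrange (map (_∷ []) (interval 0 7)) (3 ∷ 1 ∷ 2 ∷ 4 ∷ 5 ∷ 6 ∷ []) (1 ∷ 2 ∷ 3 ∷ 4 ∷ 5 ∷ 6 ∷ []) refl)
... | even (suc n) = subst (λ s → Cover 4 0 6 (2 + s)) (n+n≡n*2 n) (cover34-even n)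
... | odd 0        = cover (core34 {a = 2} {3} {4} refl refl refl) (_∷_ {a = 1} {7} refl [])
  (rearrange (map (_∷ []) (interval 0 10)) (2 ∷ 3 ∷ 4 ∷ 5 ∷ 6 ∷ 9 ∷ 1 ∷ 7 ∷ 8 ∷ [])
             (1 ∷ 2 ∷ 3 ∷ 4 ∷ 5 ∷ 6 ∷ 7 ∷ 8 ∷ 9 ∷ []) refl)
... | odd (suc n)  = subst (λ s → Cover 4 0 6 (3 + s)) (n+n≡n*2 n) (cover34-odd n)

-- Assembling arrays

strip : ∀ {t L} → Triples t L → Tile 3 (t * 2) 0 L
strip []      = flip (noRows 3)
strip (e ∷ p) = schurTile e beside strip p

quadRow : ∀ a b → Tile 2 (b * 4) 0 (interval a (b * 4))
quadRow a zero    = flip (noRows 2)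
quadRow a (suc b) = quadTile a beside quadRow (4 + a) b

quads : ∀ a c b → Tile (c * 2) (b * 4) 0 (interval a (c * (b * 4)))
quads a zero    b = noRows (b * 4)
quads a (suc c) b = tile-resp-↭ (↭-reflexive (sym (interval-++ a (b * 4) _)))
                                (quadRow a b above quads (a + b * 4) c b)

-- The added region consists of a part to the right of `T` whose width is a multiple of 4 and a part
-- below whose height is a multiple of 4. Since all sides are even, 2 × 4 pieces or their transposes
-- fill both.
extend : ∀ p q {k L} → Tile (p * 2) (q * 2) k L → ∀ a c b →
         ∃ λ l → Tile ((p + c * 2) * 2) ((q + b * 2) * 2) k (L ++ interval a l)
extend p q {k} {L} T a c b = l₁ + l₂ , extended
  where
  l₁ = p * (b * 4)
  l₂ = (q + b * 2) * (c * 4)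
  dims : ∀ p c → p * 2 + c * 4 ≡ (p + c * 2) * 2
  dims = ℕ-Solver.solve-∀
  zeros : ∀ k → k + 0 + 0 ≡ k
  zeros = ℕ-Solver.solve-∀
  values-≡ : (L ++ interval a l₁) ++ interval (a + l₁) l₂ ≡ L ++ interval a (l₁ + l₂)
  values-≡ = trans (++-assoc L _ _) (cong (L ++_) (sym (interval-++ a l₁ l₂)))
  lower : Tile (c * 4) (q * 2 + b * 4) 0 (interval (a + l₁) l₂)
  lower = subst (λ n → Tile (c * 4) n 0 (interval (a + l₁) l₂)) (sym (dims q b))
    (flip (quads (a + l₁) (q + b * 2) c))
  extended : Tile ((p + c * 2) * 2) ((q + b * 2) * 2) k (L ++ interval a (l₁ + l₂))
  extended rewrite sym (dims p c) | sym (dims q b) | sym values-≡ =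
    subst (λ k′ → Tile _ _ k′ _) (zeros k) ((T beside quads a p b) above lower)

-- The start `a` and the triples are arbitrary because they are known only once a cover for the rest
-- of the array has been chosen.
Completable : ℕ → ℕ → ℕ → Set
Completable c b t =
  ∀ a {L} → Triples t L → ∃ λ l → Tile (c * 2) (b * 2) 0 (L ++ interval a l)

flipCompletable : ∀ c b {t} → Completable c b t → Completable b c t
flipCompletable c b f a p = map₂ flip (f a p)

evenRows : ∀ c b → Completable (c * 2) b 0
evenRows c b a [] with extend 0 b (noRows (b * 2)) a c 0
... | l , T = l , subst (λ b′ → Tile (c * 2 * 2) (b′ * 2) 0 _) (ℕ.+-identityʳ b) T

-- The area is 4 modulo 8, so the 2 × 4 pieces alone cannot fill the rectangle.
oddSides : ∀ c b → Completable (1 + c * 2) (3 + b * 2) 2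
oddSides c b a {L} (e ∷ f ∷ []) =
  extend 1 3 (flip (schurTile e) beside flip (schurTile f)) a c b

-- If `c` or `b` is even, the area 4cb is divisible by 8 and no triples are used; otherwise two are.
-- The excluded 2 × 2 array with zero sums would have a single absolute value. The form `v * 2`
-- makes it easy to see that a cover with exactly one triple is never requested in `odd×odd 0 0`.
rectangle : ∀ c b → ¬ (c ≡ 1 × b ≡ 1) → ∃ λ v → Completable c b (v * 2)
rectangle c b ¬1×1 with parity c | parity b
... | even c′      | _            = 0 , evenRows c′ b
... | odd c′       | even b′      = 0 , flipCompletable (b′ * 2) c (evenRows b′ c)
... | odd c′       | odd (suc b′) = 1 , oddSides c′ b′
... | odd (suc c′) | odd 0        = 1 , flipCompletable 1 c (oddSides 0 c′)
... | odd 0        | odd 0        = contradiction (refl , refl) ¬1×1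

Complete : ℕ → ℕ → ℕ → Set
Complete m n k = ∃ λ l → Tile m n k (interval 1 l)

flipComplete : ∀ {m n k} → Complete m n k → Complete n m k
flipComplete = map₂ flip

complete-↭ : ∀ {m n k} e {l L} → L ↭ interval 1 e ++ interval (suc e) l → Tile m n k L → Complete m n k
complete-↭ e {l} p T =
  e + l , tile-resp-↭ (↭-trans p (↭-reflexive (sym (interval-++ 1 e l)))) T

-- One cover supplies `b` triples to the strip right of the core, `c` to the strip below it, and the
-- last `v * 2` to the corner rectangle.
frame : ∀ c b → ¬ (c ≡ 1 × b ≡ 1) → (∀ v → c + (b + v * 2) ≢ 1) →
        Complete (3 + c * 2) (3 + b * 2) 1
frame c b ¬1×1 t≢1 with rectangle c b ¬1×1
... | v , fits with cover33 (c + (b + v * 2)) (t≢1 v)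
... | cover {E} core ts total with triples-split c ts
... | C , _ , refl , tc , ts′ with triples-split b ts′
-- With t triples the cover ends at 4 + 3t, so the corner continues from 5 + 3t.
... | B , V , refl , tb , tv with fits (5 + 3 * (c + (b + v * 2))) tv
... | l , R = complete-↭ (4 + 3 * (c + (b + v * 2))) perm
  ((core beside strip tb) above (flip (strip tc) beside R))
  where
  I = interval _ l
  perm : (E ++ B) ++ (C ++ (V ++ I)) ↭ _ ++ I
  perm = begin
    (E ++ B) ++ (C ++ (V ++ I)) ≡⟨ ++-assoc E B _ ⟩
    E ++ (B ++ (C ++ (V ++ I))) ↭⟨ ++⁺ˡ E (shifts B C) ⟩
    E ++ (C ++ (B ++ (V ++ I))) ≡⟨ cong (λ xs → E ++ (C ++ xs)) (++-assoc B V I) ⟨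
    E ++ (C ++ ((B ++ V) ++ I)) ≡⟨ cong (E ++_) (++-assoc C (B ++ V) I) ⟨
    E ++ ((C ++ (B ++ V)) ++ I) ≡⟨ ++-assoc E _ I ⟨
    (E ++ (C ++ (B ++ V))) ++ I ↭⟨ ++⁺ʳ I total ⟩
    _ ++ I                      ∎
    where open PermutationReasoning

-- In the cases (0, 1) and (1, 0) the frame would call for a cover with exactly one triple, and in
-- the case (1, 1) it would leave a 2 × 2 corner.
odd×odd : ∀ c b → Complete (3 + c * 2) (3 + b * 2) 1
odd×odd 0 0             = frame 0 0 (λ ()) λ { zero () ; (suc _) () }
odd×odd 0 1             = 7 , tile35
odd×odd 1 0             = 7 , flip tile35
odd×odd 1 1             = 12 , tile55
odd×odd 0 (suc (suc b)) = frame 0 (2 + b) (λ ()) (λ _ ())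
odd×odd 1 (suc (suc b)) = frame 1 (2 + b) (λ { (_ , ()) }) (λ _ ())
odd×odd (suc (suc c)) b = frame (2 + c) b (λ ()) (λ _ ())

-- The rectangle below the core and its strip has width at least 4, so it is never 2 × 2, and
-- `cover34` provides any number of triples.
odd×even : ∀ c b → Complete (3 + c * 2) (4 + b * 2) 0
odd×even c b with rectangle c (2 + b) (λ { (_ , ()) })
... | v , fits with cover34 (b + v * 2)
... | cover {E} core ts total with triples-split b ts
... | B , V , refl , tb , tv with fits (7 + 3 * (b + v * 2)) tv
... | l , R = complete-↭ (6 + 3 * (b + v * 2)) perm ((core beside strip tb) above R)
  where
  I = interval _ l
  perm : (E ++ B) ++ (V ++ I) ↭ _ ++ I
  perm = begin
    (E ++ B) ++ (V ++ I) ≡⟨ ++-assoc (E ++ B) V I ⟨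
    ((E ++ B) ++ V) ++ I ≡⟨ cong (_++ I) (++-assoc E B V) ⟩
    (E ++ (B ++ V)) ++ I ↭⟨ ++⁺ʳ I total ⟩
    _ ++ I               ∎
    where open PermutationReasoning

tile66 : Tile 6 6 0 (interval 1 18)
tile66 with cover34 4
-- One triple widens the 3 × 4 core to 3 × 6; the other three form the lower half.
... | cover {E} core (e ∷ p) total = tile-resp-↭
  (↭-trans (↭-reflexive (++-assoc E _ _)) total) ((core beside schurTile e) above strip p)

even×even : ∀ c b → Complete ((2 + c) * 2) ((2 + b) * 2) 0
even×even c b with parity c | parity b
... | even c′ | _       = evenRows (suc c′) (2 + b) 1 []
... | odd c′  | even b′ = flipComplete (evenRows (suc b′) (2 + c) 1 [])
... | odd c′  | odd b′  with extend 3 3 tile66 19 c′ b′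
... | l , T = complete-↭ 18 refl T

data Sides : ℕ → Set where
  even : ∀ k → Sides ((2 + k) * 2)
  odd  : ∀ k → Sides (3 + k * 2)

sides : ∀ {n} → n > 2 → Sides n
sides {n} n>2 with parity n
sides ()             | even 0
sides (s≤s (s≤s ())) | even 1
... | even (suc (suc k)) = even k
sides (s≤s ())       | odd 0
... | odd (suc k)        = odd k

large : ∀ {m n} → m > 2 → n > 2 → Complete m n 0 ⊎ Complete m n 1
large m>2 n>2 with sides m>2 | sides n>2
... | even c | even b = inj₁ (even×even c b)
... | even c | odd b  = inj₁ (flipComplete (odd×even b c))
... | odd c  | even b = inj₁ (odd×even c b)
... | odd c  | odd b  = inj₂ (odd×odd c b)

twoRows₀ : ∀ k → Complete 2 (k * 4) 0
twoRows₀ k = k * 4 , quadRow 1 k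

twoRows₃ : ∀ k → Complete 2 (3 + k * 4) 0
twoRows₃ k = 3 + k * 4 , flip (schurTile {1} {2} refl) beside quadRow 4 k

-- From tiles to tight signed magic arrays

X-even⁺ : ∀ {N} l {x} → N ≡ l * 2 → 1 ≤ ∣ x ∣ → ∣ x ∣ ≤ l → x ∈ X N
X-even⁺ l {x} refl lo hi = even (m*n%n≡0 l 2) lo (subst (∣ x ∣ ≤_) (sym (m*n/n≡m l 2)) hi)

X-even⁻ : ∀ {N} l {x} → N ≡ l * 2 → x ∈ X N → 1 ≤ ∣ x ∣ × ∣ x ∣ ≤ l
X-even⁻ l refl (odd r _)          = contradiction (trans (sym r) (m*n%n≡0 l 2)) λ ()
X-even⁻ l {x} refl (even _ lo hi) = lo , subst (∣ x ∣ ≤_) (m*n/n≡m l 2) hi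

X-odd⁺ : ∀ {N} l {x} → N ≡ 1 + l * 2 → ∣ x ∣ ≤ l → x ∈ X N
X-odd⁺ l {x} refl hi = odd ([m+kn]%n≡m%n 1 l 2) (subst (∣ x ∣ ≤_) (sym (m*n/n≡m l 2)) hi)

X-odd⁻ : ∀ {N} l {x} → N ≡ 1 + l * 2 → x ∈ X N → ∣ x ∣ ≤ l
X-odd⁻ l {x} refl (odd _ hi) = subst (∣ x ∣ ≤_) (m*n/n≡m l 2) hi
X-odd⁻ l refl (even r _ _)   = contradiction (trans (sym r) ([m+kn]%n≡m%n 1 l 2)) λ ()

∈-interval⁺ : ∀ a l {x} → a ≤ x → x < a + l → x ∈ˡ interval a l
∈-interval⁺ a zero    {x} a≤x x<a+0 =
  contradiction (subst (x <_) (ℕ.+-identityʳ a) x<a+0) (ℕ.≤⇒≯ a≤x)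
∈-interval⁺ a (suc l) {x} a≤x x<a+l with ℕ.m≤n⇒m<n∨m≡n a≤x
... | inj₁ a<x  = there (∈-interval⁺ (suc a) l a<x (subst (x <_) (ℕ.+-suc a l) x<a+l))
... | inj₂ refl = here refl

∈-interval⁻ : ∀ a l {x} → x ∈ˡ interval a l → a ≤ x × x < a + l
∈-interval⁻ a (suc l) (here refl) = ℕ.≤-refl , ℕ.m<m+n a (s≤s z≤n)
∈-interval⁻ a (suc l) {x} (there p) with ∈-interval⁻ (suc a) l p
... | a<x , x<a+l = ℕ.<⇒≤ a<x , subst (x <_) (sym (ℕ.+-suc a l)) x<a+l

∈-signed⁺ : ∀ x {L} → ∣ x ∣ ∈ˡ L → x ∈ˡ signed L
∈-signed⁺ (+ _)    (here refl) = here refl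
∈-signed⁺ -[1+ _ ] (here refl) = there (here refl)
∈-signed⁺ x        (there p)   = there (there (∈-signed⁺ x p))

∈-signed⁻ : ∀ {x} L → x ∈ˡ signed L → ∣ x ∣ ∈ˡ L
∈-signed⁻ (_ ∷ _) (here refl)         = here refl
∈-signed⁻ (k ∷ _) (there (here refl)) = here (ℤ.∣-i∣≡∣i∣ (+ k))
∈-signed⁻ (_ ∷ L) (there (there p))   = there (∈-signed⁻ L p)

signed-interval⁻ : ∀ a l {x} → x ∈ˡ signed (interval a l) → a ≤ ∣ x ∣ × ∣ x ∣ < a + l
signed-interval⁻ a l p = ∈-interval⁻ a l (∈-signed⁻ (interval a l) p)

signed-interval⁺ : ∀ a l x → a ≤ ∣ x ∣ → ∣ x ∣ < a + l → x ∈ˡ signed (interval a l)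
signed-interval⁺ a l x lo hi = ∈-signed⁺ x (∈-interval⁺ a l lo hi)

∉⇒unique-∷ : ∀ {a} {A : Set a} {x : A} {xs} → x ∉ˡ xs → Unique xs → Unique (x ∷ xs)
∉⇒unique-∷ x∉xs u = ¬Any⇒All¬ _ x∉xs ∷ u

-- Starting at `suc a` keeps out 0, which `signed` would list twice.
signed-interval-unique : ∀ a l → Unique (signed (interval (suc a) l))
signed-interval-unique a zero    = []
signed-interval-unique a (suc l) =
  ∉⇒unique-∷ (λ { (here ()) ; (there p) → fresh refl p })
    (∉⇒unique-∷ (fresh refl) (signed-interval-unique (suc a) l))
  where
  fresh : ∀ {x} → ∣ x ∣ ≡ suc a → x ∉ˡ signed (interval (2 + a) l)
  fresh e p = ℕ.<⇒≢ (proj₁ (signed-interval⁻ (2 + a) l p)) (sym e)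

∈-contents⁺ : ∀ {m n} (A : Array m n) i j → A i j ∈ˡ contents A
∈-contents⁺ A zero    j = ∈-++⁺ˡ (∈-tabulate⁺ j)
∈-contents⁺ A (suc i) j = ∈-++⁺ʳ (tabulate (A zero)) (∈-contents⁺ (tail A) i j)

∈-contents⁻ : ∀ {m n} (A : Array m n) {x} → x ∈ˡ contents A → ∃₂ λ i j → A i j ≡ x
∈-contents⁻ {suc m} A p with ∈-++⁻ (tabulate (A zero)) p
... | inj₁ q = zero , map₂ sym (∈-tabulate⁻ q)
... | inj₂ q with ∈-contents⁻ (tail A) q
...   | i , j , e = suc i , j , e

unique-++⁻ : ∀ {a} {A : Set a} (xs : List A) {ys} → Unique (xs ++ ys) →
             Unique xs × Unique ys × (∀ {x} → x ∈ˡ xs → x ∉ˡ ys)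
unique-++⁻ []       u = [] , u , λ ()
unique-++⁻ (x ∷ xs) (x∉ ∷ u) with unique-++⁻ xs u
... | uxs , uys , disjoint =
  All.tabulate (λ p → All.lookup x∉ (∈-++⁺ˡ p)) ∷ uxs , uys ,
  λ { (here refl) q → All.lookup x∉ (∈-++⁺ʳ xs q) refl ; (there p) q → disjoint p q }

unique-tabulate⁻ : ∀ {a} {A : Set a} {n} {f : Fin n → A} → Unique (tabulate f) →
                   ∀ {i j} → f i ≡ f j → i ≡ j
unique-tabulate⁻ u        {zero}  {zero}  e = refl
unique-tabulate⁻ (f∉ ∷ _) {zero}  {suc j} e = contradiction e (All.lookup f∉ (∈-tabulate⁺ j))
unique-tabulate⁻ (f∉ ∷ _) {suc i} {zero}  e = contradiction (sym e) (All.lookup f∉ (∈-tabulate⁺ i))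
unique-tabulate⁻ (_ ∷ u)  {suc i} {suc j} e = cong suc (unique-tabulate⁻ u e)

unique-contents⁻ : ∀ {m n} (A : Array m n) → Unique (contents A) →
                  ∀ {i j i′ j′} → A i j ≡ A i′ j′ → (i , j) ≡ (i′ , j′)
unique-contents⁻ {suc m} A u {i} {j} {i′} {j′} e with unique-++⁻ (tabulate (A zero)) u | i | i′
... | u₀ , _ , _        | zero  | zero   = cong (zero ,_) (unique-tabulate⁻ u₀ e)
... | _  , u₊ , _       | suc i | suc i′ =
  cong (λ (i , j) → suc i , j) (unique-contents⁻ (tail A) u₊ e)
... | _ , _ , disjoint  | zero  | suc i′ =
  contradiction (subst (_∈ˡ contents (tail A)) (sym e) (∈-contents⁺ (tail A) i′ j′)) (disjoint (∈-tabulate⁺ j))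
... | _ , _ , disjoint  | suc i | zero   =
  contradiction (subst (_∈ˡ contents (tail A)) e (∈-contents⁺ (tail A) i j)) (disjoint (∈-tabulate⁺ j′))

length-contents : ∀ {m n} (A : Array m n) → length (contents A) ≡ m * n
length-contents {zero}  A = refl
length-contents {suc m} A = trans (length-++ (tabulate (A zero)))
  (cong₂ _+_ (length-tabulate (A zero)) (length-contents (tail A)))

length-signed-interval : ∀ a l → length (signed (interval a l)) ≡ l * 2
length-signed-interval a zero    = refl
length-signed-interval a (suc l) = cong (λ k → suc (suc k)) (length-signed-interval (suc a) l)

-- `xs` enumerates `X` without repetition. Membership carried along the permutation gives existence
-- in `once`, and the absence of repetitions gives uniqueness of the position.
isTightSMA : ∀ {m n xs} {A : Array m n} → (∀ i → sum (A i) ≡ 0ℤ) → (∀ j → sum (transpose A j) ≡ 0ℤ) →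
             contents A ↭ xs → Unique xs → (∀ {x} → x ∈ˡ xs → x ∈ X (m * n)) →
             (∀ {x} → x ∈ X (m * n) → x ∈ˡ xs) → IsTightSMA m n A
isTightSMA {m} {n} {xs} {A} rows columns p u sound complete = record
  { entries   = λ i j → sound (∈-resp-↭ p (∈-contents⁺ A i j))
  ; once      = once
  ; rowSum    = rows
  ; columnSum = columns
  }
  where
  once : ∀ x → x ∈ X (m * n) → ∃! {A = Fin m × Fin n} _≡_ λ (i , j) → A i j ≡ x
  once x x∈X with ∈-contents⁻ A (∈-resp-↭ (↭-sym p) (complete x∈X))
  ... | i , j , e = (i , j) , e , λ e′ →
    unique-contents⁻ A (↭ₛ.Unique-resp-↭ (setoid ℤ) (↭⇒↭ₛ (↭-sym p)) u) (trans e (sym e′))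

-- Counting cells gives m n = 2l. This identifies the length `l`, left existential by the
-- constructions, with the bound in `X`.
complete₀ : ∀ {m n} → Complete m n 0 → ∃ (IsTightSMA m n)
complete₀ {m} {n} (l , T) = -, isTightSMA (Tile.rowSums T) (Tile.columnSums T) (Tile.contents-↭ T)
  (signed-interval-unique 0 l)
  (λ p → let lo , hi = signed-interval⁻ 1 l p in X-even⁺ l size lo (ℕ.≤-pred hi))
  (λ {x} q → let lo , hi = X-even⁻ l size q in signed-interval⁺ 1 l x lo (s≤s hi))
  where
  size : m * n ≡ l * 2
  size = trans (sym (length-contents (Tile.cells T)))
         (trans (↭-length (Tile.contents-↭ T)) (length-signed-interval 1 l))

complete₁ : ∀ {m n} → Complete m n 1 → ∃ (IsTightSMA m n)
complete₁ {m} {n} (l , T) = -, isTightSMA (Tile.rowSums T) (Tile.columnSums T) (Tile.contents-↭ T)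
  (∉⇒unique-∷ (λ p → contradiction (proj₁ (signed-interval⁻ 1 l p)) λ ()) (signed-interval-unique 0 l))
  sound complete
  where
  size : m * n ≡ 1 + l * 2
  size = trans (sym (length-contents (Tile.cells T)))
         (trans (↭-length (Tile.contents-↭ T)) (cong suc (length-signed-interval 1 l)))
  sound : ∀ {x} → x ∈ˡ values 1 (interval 1 l) → x ∈ X (m * n)
  sound (here refl) = X-odd⁺ l size z≤n
  sound (there p)   = X-odd⁺ l size (ℕ.≤-pred (proj₂ (signed-interval⁻ 1 l p)))
  complete : ∀ {x} → x ∈ X (m * n) → x ∈ˡ values 1 (interval 1 l)
  complete {x} q with ∣ x ∣ in e
  ... | zero  = here (ℤ.∣i∣≡0⇒i≡0 e)
  ... | suc k = there (signed-interval⁺ 1 l x (subst (1 ≤_) (sym e) (s≤s z≤n)) (s≤s (X-odd⁻ l size q)))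

transpose-SMA : ∀ {m n} → ∃ (IsTightSMA m n) → ∃ (IsTightSMA n m)
transpose-SMA {m} {n} (A , T) = transpose A , record
  { entries   = λ i j → subst (λ N → A j i ∈ X N) (ℕ.*-comm m n) (T.entries j i)
  ; once      = once
  ; rowSum    = T.columnSum
  ; columnSum = T.rowSum
  }
  where
  module T = IsTightSMA T
  once : ∀ x → x ∈ X (n * m) → ∃! {A = Fin n × Fin m} _≡_ λ (i , j) → A j i ≡ x
  once x x∈X with T.once x (subst (λ N → x ∈ X N) (ℕ.*-comm n m) x∈X)
  ... | p , e , unique = swap p , e , λ e′ → cong swap (unique e′)

entry-injective : ∀ {m n A} → IsTightSMA m n A → ∀ {i j i′ j′} → A i j ≡ A i′ j′ → (i , j) ≡ (i′ , j′)
entry-injective T {i} {j} e with IsTightSMA.once T _ (IsTightSMA.entries T i j)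
... | _ , _ , unique = trans (sym (unique refl)) (unique (sym e))

-- Necessity

1∈X : ∀ {n} → n > 1 → + 1 ∈ X n
1∈X {n} n>1 with parity n
1∈X n>1      | even (suc k) = X-even⁺ (suc k) refl (s≤s z≤n) (s≤s z≤n)
1∈X (s≤s ()) | odd zero
1∈X n>1      | odd (suc k)  = X-odd⁺ (suc k) refl (s≤s z≤n)

-- Column sums are single entries, hence all entries are 0, yet 1 must occur.
¬oneRow : ∀ {n} → n > 1 → ¬ ∃ (IsTightSMA 1 n)
¬oneRow {n} n>1 (A , T)
  with IsTightSMA.once T (+ 1) (subst (λ N → + 1 ∈ X N) (sym (ℕ.*-identityˡ n)) (1∈X n>1))
... | (zero , j) , e , _ = contradiction (trans (cong (ℤ._+ 0ℤ) (sym e)) (IsTightSMA.columnSum T j)) λ ()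

-- An integer and its absolute value have the same parity; `y` is half the difference of the two
-- sums.
sum-∣∣ : ∀ {n} (v : Vector ℤ n) → ∃ λ y → + ℕ-Sum.sum (∣_∣ ∘ v) ≡ sum v ℤ.+ (y ℤ.+ y)
sum-∣∣ {zero}  v = 0ℤ , refl
sum-∣∣ {suc n} v with sum-∣∣ (tail v) | half (v zero)
  where
  half : ∀ x → ∃ λ y → + ∣ x ∣ ≡ x ℤ.+ (y ℤ.+ y)
  half (+ k)    = 0ℤ , sym (ℤ.+-identityʳ (+ k))
  half -[1+ k ] = + suc k , eq (+ suc k)
    where
    eq : ∀ y → y ≡ - y ℤ.+ (y ℤ.+ y)
    eq = ℤ-Solver.solve-∀
... | y , e | z , f = y ℤ.+ z , trans (cong₂ ℤ._+_ f e) (regroup (v zero) (sum (tail v)) y z)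
  where
  regroup : ∀ a s y z → a ℤ.+ (z ℤ.+ z) ℤ.+ (s ℤ.+ (y ℤ.+ y)) ≡ a ℤ.+ s ℤ.+ (y ℤ.+ z ℤ.+ (y ℤ.+ z))
  regroup = ℤ-Solver.solve-∀

-- This is 2S = n(2c + n - 1) with n added to both sides to avoid subtraction. The start `c` is
-- general because the induction passes to `suc c`.
sum-consecutive : ∀ c n → ℕ-Sum.sum {n} (λ i → c + toℕ i) * 2 + n ≡ n * (2 * c + n)
sum-consecutive c zero    = refl
sum-consecutive c (suc n) = begin
  (c + 0 + ℕ-Sum.sum {n} (λ i → c + suc (toℕ i))) * 2 + suc n
    ≡⟨ cong (λ s → (c + 0 + s) * 2 + suc n) (ℕ-Sum.sum-cong-≗ {n} (λ i → ℕ.+-suc c (toℕ i))) ⟩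
  (c + 0 + s) * 2 + suc n ≡⟨ regroup c s n ⟩
  s * 2 + n + (2 * c + 1) ≡⟨ cong (_+ (2 * c + 1)) (sum-consecutive (suc c) n) ⟩
  n * (2 * suc c + n) + (2 * c + 1) ≡⟨ expand c n ⟩
  suc n * (2 * c + suc n) ∎
  where
  open ≡-Reasoning
  s = ℕ-Sum.sum {n} (λ i → suc c + toℕ i)
  regroup : ∀ c s n → (c + 0 + s) * 2 + suc n ≡ s * 2 + n + (2 * c + 1)
  regroup = ℕ-Solver.solve-∀
  expand : ∀ c n → n * (2 * suc c + n) + (2 * c + 1) ≡ suc n * (2 * c + suc n)
  expand = ℕ-Solver.solve-∀

∣∣-≡ : ∀ x y → ∣ x ∣ ≡ ∣ y ∣ → x ≡ y ⊎ x ≡ - y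
∣∣-≡ (+ _)    (+ _)    refl = inj₁ refl
∣∣-≡ (+ _)    -[1+ _ ] refl = inj₂ refl
∣∣-≡ -[1+ _ ] (+ _)    refl = inj₂ refl
∣∣-≡ -[1+ _ ] -[1+ _ ] refl = inj₁ refl

-- Arrays with two rows

module TwoRows {n} (A : Array 2 n) (T : IsTightSMA 2 n A) where
  open IsTightSMA T

  second : ∀ j → A (suc zero) j ≡ - A zero j
  second j = trans (solve (A zero j) (A (suc zero) j))
    (trans (cong (ℤ._+ - A zero j) (columnSum j)) (ℤ.+-identityˡ _))
    where
    solve : ∀ x y → y ≡ x ℤ.+ (y ℤ.+ 0ℤ) ℤ.+ - x
    solve = ℤ-Solver.solve-∀

  magnitude : ∀ i j → ∣ A i j ∣ ≡ ∣ A zero j ∣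
  magnitude zero       j = refl
  magnitude (suc zero) j = trans (cong ∣_∣ (second j)) (ℤ.∣-i∣≡∣i∣ (A zero j))

  -- If the two entries were opposite, the entry in the first row of column j would recur in the
  -- second row of column j′.
  magnitude-injective : ∀ {j j′} → ∣ A zero j ∣ ≡ ∣ A zero j′ ∣ → j ≡ j′
  magnitude-injective {j} {j′} e with ∣∣-≡ (A zero j) (A zero j′) e
  ... | inj₁ f = cong proj₂ (entry-injective T f)
  ... | inj₂ f with () ← entry-injective T (trans f (sym (second j′)))

  bounds : ∀ j → 1 ≤ ∣ A zero j ∣ × ∣ A zero j ∣ ≤ n
  bounds j = X-even⁻ n (ℕ.*-comm 2 n) (entries zero j)

  suc-pred : ∀ j → suc (pred ∣ A zero j ∣) ≡ ∣ A zero j ∣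
  suc-pred j = ℕ.suc-pred ∣ A zero j ∣ {{>-nonZero (proj₁ (bounds j))}}

  rank : Fin n → Fin n
  rank j = fromℕ< (subst (_≤ n) (sym (suc-pred j)) (proj₂ (bounds j)))

  suc-rank : ∀ j → suc (toℕ (rank j)) ≡ ∣ A zero j ∣
  suc-rank j = trans (cong suc (toℕ-fromℕ< _)) (suc-pred j)

  position : ∀ k → ∃ λ j → ∣ A zero j ∣ ≡ suc (toℕ k)
  position k with once (+ suc (toℕ k)) (X-even⁺ n (ℕ.*-comm 2 n) (s≤s z≤n) (toℕ<n k))
  ... | (i , j) , e , _ = j , trans (sym (magnitude i j)) (cong ∣_∣ e)

  -- The absolute values in the first row are 1, ..., n in some order: `rank` permutes the columns,
  -- with inverse `position`.
  sum-magnitudes : ℕ-Sum.sum {n} (λ j → ∣ A zero j ∣) ≡ ℕ-Sum.sum {n} (λ k → 1 + toℕ k)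
  sum-magnitudes = sym (trans
    (ℕ-Sum.sum-permute {n} (λ k → 1 + toℕ k) (permutation rank (proj₁ ∘ position)
      (λ k → toℕ-injective (ℕ.suc-injective (trans (suc-rank _) (proj₂ (position k)))))
      (λ j → magnitude-injective (trans (proj₂ (position (rank j))) (suc-rank j)))))
    (ℕ-Sum.sum-cong-≗ {n} suc-rank))

  -- As the row sum is 0, `sum-∣∣` writes the sum 1 + ... + n as y + y. A negative `y` is impossible
  -- because that sum is a natural number.
  n[n+1] : ∃ λ k → k * 4 ≡ n * (1 + n)
  n[n+1] with sum-∣∣ (A zero)
  ... | y , e with y | trans (cong +_ (sym sum-magnitudes)) (trans e (cong (ℤ._+ (y ℤ.+ y)) (rowSum zero)))
  ... | + k      | f = k , ℕ.+-cancelʳ-≡ n _ _ (begin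
    k * 4 + n       ≡⟨ double k n ⟩
    (k + k) * 2 + n ≡⟨ cong (λ s → s * 2 + n) (ℤ.+-injective (trans f (ℤ.+-identityˡ _))) ⟨
    _               ≡⟨ sum-consecutive 1 n ⟩
    n * (2 + n)     ≡⟨ expand n ⟩
    n * (1 + n) + n ∎)
    where
    open ≡-Reasoning
    double : ∀ k n → k * 4 + n ≡ (k + k) * 2 + n
    double = ℕ-Solver.solve-∀
    expand : ∀ n → n * (2 + n) ≡ n * (1 + n) + n
    expand = ℕ-Solver.solve-∀
  n[n+1] | y , e | -[1+ _ ] | ()

4k≢4z+2 : ∀ k z → k * 4 ≢ 2 + z * 4
4k≢4z+2 k z e with () ← trans (sym (m*n%n≡0 k 4)) (trans (cong (_% 4) e) ([m+kn]%n≡m%n 2 z 4))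

-- For n congruent to 1 or 2 modulo 4, expanding the product shows that n(n + 1) leaves remainder 2.
n[n+1]%4 : ∀ n k → k * 4 ≡ n * (1 + n) → n % 4 ≡ 0 ⊎ n % 4 ≡ 3
n[n+1]%4 n k e with n % 4 | m≡m%n+[m/n]*n n 4 | m%n<n n 4
... | 0 | _ | _ = inj₁ refl
... | 3 | _ | _ = inj₂ refl
... | 1 | f | _ = contradiction
  (trans e (trans (cong (λ n → n * (1 + n)) f) (eq (n / 4)))) (4k≢4z+2 k (3 * (n / 4) + 4 * (n / 4) * (n / 4)))
  where
  eq : ∀ q → (1 + q * 4) * (2 + q * 4) ≡ 2 + (3 * q + 4 * q * q) * 4
  eq = ℕ-Solver.solve-∀
... | 2 | f | _ = contradiction
  (trans e (trans (cong (λ n → n * (1 + n)) f) (eq (n / 4)))) (4k≢4z+2 k (1 + 5 * (n / 4) + 4 * (n / 4) * (n / 4)))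
  where
  eq : ∀ q → (2 + q * 4) * (3 + q * 4) ≡ 2 + (1 + 5 * q + 4 * q * q) * 4
  eq = ℕ-Solver.solve-∀
... | suc (suc (suc (suc _))) | _ | s≤s (s≤s (s≤s (s≤s ())))

twoRows⁻ : ∀ {n} → ∃ (IsTightSMA 2 n) → n % 4 ≡ 0 ⊎ n % 4 ≡ 3
twoRows⁻ {n} (A , T) with TwoRows.n[n+1] A T
... | k , e = n[n+1]%4 n k e

twoRows⁺ : ∀ {n} → n % 4 ≡ 0 ⊎ n % 4 ≡ 3 → ∃ (IsTightSMA 2 n)
twoRows⁺ {n} (inj₁ r) = subst (∃ ∘ IsTightSMA 2)
  (sym (trans (m≡m%n+[m/n]*n n 4) (cong (_+ n / 4 * 4) r))) (complete₀ (twoRows₀ (n / 4)))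
twoRows⁺ {n} (inj₂ r) = subst (∃ ∘ IsTightSMA 2)
  (sym (trans (m≡m%n+[m/n]*n n 4) (cong (_+ n / 4 * 4) r))) (complete₀ (twoRows₃ (n / 4)))

-- Characterization of the possible sizes

tile11 : Tile 1 1 1 []
tile11 = record { cells = λ _ _ → 0ℤ ; rowSums = λ _ → refl ; columnSums = λ _ → refl ; contents-↭ = refl }

Admissible : ℕ → ℕ → Set
Admissible m n =
    (m ≡ 1 × n ≡ 1)
  ⊎ (m ≡ 2 × (n % 4 ≡ 0 ⊎ n % 4 ≡ 3))
  ⊎ (n ≡ 2 × (m % 4 ≡ 0 ⊎ m % 4 ≡ 3))
  ⊎ (m > 2 × n > 2)

necessary : ∀ m n .{{_ : NonZero m}} .{{_ : NonZero n}} → ∃ (IsTightSMA m n) → Admissible m n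
necessary 1 1 _ = inj₁ (refl , refl)
necessary 1 (suc (suc n)) A = contradiction A (¬oneRow (s≤s (s≤s z≤n)))
necessary (suc (suc m)) 1 A = contradiction (transpose-SMA A) (¬oneRow (s≤s (s≤s z≤n)))
necessary 2 (suc (suc n)) A = inj₂ (inj₁ (refl , twoRows⁻ A))
necessary (suc (suc (suc m))) 2 A = inj₂ (inj₂ (inj₁ (refl , twoRows⁻ (transpose-SMA A))))
necessary (suc (suc (suc m))) (suc (suc (suc n))) _ =
  inj₂ (inj₂ (inj₂ (s≤s (s≤s (s≤s z≤n)) , s≤s (s≤s (s≤s z≤n)))))

sufficient : ∀ {m n} → Admissible m n → ∃ (IsTightSMA m n)
sufficient (inj₁ (refl , refl))               = complete₁ (0 , tile11)
sufficient (inj₂ (inj₁ (refl , r)))           = twoRows⁺ r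
sufficient (inj₂ (inj₂ (inj₁ (refl , r))))    = transpose-SMA (twoRows⁺ r)
sufficient (inj₂ (inj₂ (inj₂ (m>2 , n>2))))   = [ complete₀ , complete₁ ]′ (large m>2 n>2)

theorem4 : ∀ (m n : ℕ) .{{_ : NonZero m}} .{{_ : NonZero n}} →
    ∃ (IsTightSMA m n) ⇔
    ( (m ≡ 1 × n ≡ 1)
    ⊎ (m ≡ 2 × (n % 4 ≡ 0 ⊎ n % 4 ≡ 3))
    ⊎ (n ≡ 2 × (m % 4 ≡ 0 ⊎ m % 4 ≡ 3))
    ⊎ (m > 2 × n > 2) )
theorem4 m n = mk⇔ (necessary m n) sufficient
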